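{- Let $G=(V,E)$ be a finite, simple (loop-free) undirected graph with $|E|=q$, and let $w:E\to\{1,\ldots,q\}$ be a weight function assigning different weights to different edges. For $0\le i\le q$ and $v\in V$ let $L^i(v)$ be the length of a longest strictly decreasing trail starting at $v$ that uses only edges of weight at most $i$. If $0\le i<q$, then $$\sum_{v\in V} L^{i+1}(v)\ \ge\ \sum_{v\in V} L^{i}(v)+2 .$$
   Context: Edges are undirected, and $|E|$ counts each undirected edge once. A trail of length $k\ge 0$ in $G$ is a sequence $(e_1,\ldots,e_k)$ of distinct edges for which there is a sequence of vertices $(v_0,\ldots,v_k)$ with $e_j=v_{j-1}v_j$ for all $1\le j\le k$; it starts at $v_0$ (vertices may repeat; the empty trail at $v$ has length $0$). A trail is strictly decreasing (with respect to $w$) if $w(e_j)>w(e_{j+1})$ for all $1\le j<k$. -}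

module Defs where

open import Data.Bool.Base using (Bool; T)
open import Data.Bool.Properties using (T?; T-irrelevant)
open import Data.Fin.Base using (Fin; _<_)
import Data.Fin.Properties as Fin
open import Data.List.Base using (List; []; _∷_; length)
open import Data.List.Relation.Unary.All as All using (All; []; _∷_)
open import Data.List.Relation.Unary.Linked as Linked using (Linked; []; [-]; _∷_)
open import Data.List.Relation.Unary.Unique.Propositional using (Unique)
open import Data.List.Relation.Unary.AllPairs using (allPairs?; [])
open import Data.Nat.Base using (ℕ; zero; suc; z≤n; s≤s; _≤_; _>_)
import Data.Nat.Properties as ℕ
open import Data.Product.Base using (∃; ∃-syntax; _×_; _,_; proj₁)
open import Data.Sum.Base using (_⊎_)
open import Level using (0ℓ)
open import Relation.Binary.Core using (Rel)
open import Relation.Binary.Definitions using (Symmetric; Irreflexive; DecidableEquality)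
open import Relation.Binary.PropositionalEquality using (_≡_; refl)
open import Relation.Nullary.Decidable using (Dec; yes; no; map′; _×-dec_; _⊎-dec_; ¬?)
open import Relation.Nullary.Negation using (contradiction)
open import Relation.Unary using (Pred; Decidable)

record SimpleGraph (n : ℕ) : Set where
  field
    adjacent : Fin n → Fin n → Bool

  _~_ : Rel (Fin n) 0ℓ
  u ~ v = T (adjacent u v)

  field
    ~-sym    : Symmetric _~_
    ~-irrefl : Irreflexive _≡_ _~_

-- An undirected edge is recorded once, with its endpoints in increasing order.
-- Both proof fields are propositions, so edges are equal iff their endpoints are.
record Edge {n : ℕ} (G : SimpleGraph n) : Set where
  constructor edge
  open SimpleGraph G
  field
    lo hi : Fin n
    lo<hi : lo < hi
    lo~hi : lo ~ hi

module _ {n : ℕ} {G : SimpleGraph n} where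
  open SimpleGraph G
  open Edge

  Joins : Edge G → Fin n → Fin n → Set
  Joins e u v = (lo e ≡ u × hi e ≡ v) ⊎ (lo e ≡ v × hi e ≡ u)

  -- The edges e₁ , … , eₖ admit vertices v₀ , … , vₖ with eⱼ = vⱼ₋₁vⱼ and v₀ = v.
  data WalkFrom (v : Fin n) : List (Edge G) → Set where
    []  : WalkFrom v []
    _∷_ : ∀ {e u es} → Joins e v u → WalkFrom u es → WalkFrom v (e ∷ es)

  TrailFrom : Fin n → List (Edge G) → Set
  TrailFrom v es = Unique es × WalkFrom v es

  StrictlyDecreasing : (Edge G → ℕ) → List (Edge G) → Set
  StrictlyDecreasing w = Linked (λ e f → w e > w f)

  Admissible : (Edge G → ℕ) → ℕ → Fin n → List (Edge G) → Set
  Admissible w i v es =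
    TrailFrom v es × StrictlyDecreasing w es × All (λ e → w e ≤ i) es

  IsLongestLength : (Edge G → ℕ) → ℕ → Fin n → ℕ → Set
  IsLongestLength w i v ℓ =
    (∃[ es ] Admissible w i v es × length es ≡ ℓ) ×
    (∀ es → Admissible w i v es → length es ≤ ℓ)

  _≟ᴱ_ : DecidableEquality (Edge G)
  edge a b p q ≟ᴱ edge c d r s = map′ to from ((a Fin.≟ c) ×-dec (b Fin.≟ d))
    where
    to : a ≡ c × b ≡ d → edge a b p q ≡ edge c d r s
    to (refl , refl) with refl ← ℕ.<-irrelevant p r | refl ← T-irrelevant q s = refl

    from : edge a b p q ≡ edge c d r s → a ≡ c × b ≡ d
    from refl = refl , refl

  anyEdge? : {P : Pred (Edge G) 0ℓ} → Decidable P → Dec (∃ P)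
  anyEdge? {P} P? = map′ to from (Fin.any? λ a → Fin.any? λ b → at? a b)
    where
    At : Fin n → Fin n → Set
    At a b = ∃[ p ] ∃[ q ] P (edge a b p q)

    at? : ∀ a b → Dec (At a b)
    at? a b with a Fin.<? b | T? (adjacent a b)
    ... | no a≮b | _      = no λ (p , _) → a≮b p
    ... | yes _  | no a≁b = no λ (_ , q , _) → a≁b q
    ... | yes p  | yes q  = map′ (λ x → p , q , x) same (P? (edge a b p q))
      where
      same : At a b → P (edge a b p q)
      same (p′ , q′ , x)
        with refl ← ℕ.<-irrelevant p p′ | refl ← T-irrelevant q q′ = x

    to : (∃[ a ] ∃[ b ] At a b) → ∃ P
    to (_ , _ , _ , _ , x) = _ , x

    from : ∃ P → ∃[ a ] ∃[ b ] At a b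
    from (edge a b p q , x) = a , b , p , q , x

  anyOfLength? : {P : Pred (List (Edge G)) 0ℓ} → Decidable P →
                 ∀ k → Dec (∃[ es ] P es × length es ≡ k)
  anyOfLength? P? zero =
    map′ (λ x → [] , x , refl) (λ { ([] , x , _) → x }) (P? [])
  anyOfLength? P? (suc k) =
    map′ (λ { (e , es , x , refl) → e ∷ es , x , refl })
         (λ { (e ∷ es , x , refl) → e , es , x , refl })
         (anyEdge? λ e → anyOfLength? (λ es → P? (e ∷ es)) k)

  joins? : ∀ e u v → Dec (Joins e u v)
  joins? e u v = ((lo e Fin.≟ u) ×-dec (hi e Fin.≟ v))
           ⊎-dec ((lo e Fin.≟ v) ×-dec (hi e Fin.≟ u))

  walkFrom? : ∀ v → Decidable (WalkFrom v)
  walkFrom? v []       = yes []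
  walkFrom? v (e ∷ es) =
    map′ (λ (_ , j , p) → j ∷ p) (λ { (j ∷ p) → _ , j , p })
         (Fin.any? λ u → joins? e v u ×-dec walkFrom? u es)

  admissible? : ∀ w i v → Decidable (Admissible w i v)
  admissible? w i v es =
    (allPairs? (λ e f → ¬? (e ≟ᴱ f)) es ×-dec walkFrom? v es)
    ×-dec Linked.linked? (λ e f → w f ℕ.<? w e) es
    ×-dec All.all? (λ e → w e ℕ.≤? i) es

  admissible-length≤ : ∀ w i v es → Admissible w i v es → length es ≤ suc i
  admissible-length≤ w i v []       _                   = z≤n
  admissible-length≤ w i v (e ∷ es) (_ , dec , we≤i ∷ _) =
    s≤s (ℕ.≤-trans (tail≤ dec) we≤i)
    where
    tail≤ : ∀ {e es} → StrictlyDecreasing w (e ∷ es) → length es ≤ w e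
    tail≤ [-]         = z≤n
    tail≤ (gt ∷ rest) = ℕ.≤-<-trans (tail≤ rest) gt

  -- Search downwards from i + 1, a bound for any ℕ-valued w (weight 0 allowed).
  longest : ∀ w i v → ∃ (IsLongestLength w i v)
  longest w i v = search (suc i) (admissible-length≤ w i v)
    where
    search : ∀ b → (∀ es → Admissible w i v es → length es ≤ b) →
             ∃ (IsLongestLength w i v)
    search b bound with anyOfLength? (admissible? w i v) b
    search b       bound | yes found = b , found , bound
    search zero    bound | no ¬found =
      contradiction ([] , (([] , []) , [] , []) , refl) ¬found
    search (suc b) bound | no ¬found = search b λ es adm →
      ℕ.≤-pred (ℕ.≤∧≢⇒< (bound es adm) λ eq → ¬found (es , adm , eq))

  L : (Edge G → ℕ) → ℕ → Fin n → ℕ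
  L w i v = proj₁ (longest w i v)

{-# OPTIONS --safe #-}

-- By the pigeonhole principle some edge uv has weight i + 1. Prepending it to a
-- longest trail from v of weights ≤ i gives Lⁱ⁺¹(u) > Lⁱ(v), and symmetrically
-- Lⁱ⁺¹(v) > Lⁱ(u), while Lⁱ⁺¹ ≥ Lⁱ everywhere. So Lⁱ⁺¹ dominates Lⁱ with its
-- values at u and v exchanged, strictly at these two vertices.
module Submission where

open import Defs
open import Data.Nat.Base using (ℕ; suc; _+_; _≤_; _<_; _≥_)
open import Data.Nat.Properties using (+-0-commutativeMonoid)
open import Data.Fin.Base using (Fin)
open import Data.Product.Base using (_×_)
open import Function.Bundles using (_↔_)
open import Function.Definitions using (Injective)
open import Relation.Binary.PropositionalEquality using (_≡_)
open import Algebra.Properties.CommutativeMonoid.Sum +-0-commutativeMonoid using (sum)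

open import Algebra.Properties.CommutativeMonoid.Sum +-0-commutativeMonoid using (sum-permute)
open import Data.Empty using (⊥-elim)
open import Data.Fin.Base using (zero; suc; fromℕ<; punchOut)
open import Data.Fin.Permutation using (transpose; _⟨$⟩ʳ_)
open import Data.Fin.Properties
  using (_≟_; any?; punchOut-injective; <⇒≢; <⇒notInjective; fromℕ<-injective)
open import Data.List.Base using (_∷_)
open import Data.List.Relation.Unary.All as All using (All; []; _∷_)
open import Data.List.Relation.Unary.AllPairs using (_∷_)
open import Data.List.Relation.Unary.Linked using ([-]; _∷_)
open import Data.Nat.Base using (zero; z≤n; s≤s; pred; >-nonZero)
import Data.Nat.Properties as ℕ
open import Data.Product.Base using (∃-syntax; _,_; proj₁; proj₂)
open import Data.Sum.Base using (inj₁; inj₂)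
open import Data.Vec.Functional using (Vector)
open import Function.Base using (_∘_)
open import Function.Bundles using (Inverse; Injection)
open import Function.Properties.Inverse using (↔-sym; ↔⇒↣)
open import Relation.Binary.PropositionalEquality
  using (_≢_; refl; sym; trans; cong; subst)
open import Relation.Nullary.Decidable using (yes; no)
open import Relation.Nullary.Negation using (contradiction)

-- If `y` were missed, punching it out of the codomain would leave an injection from `Fin (suc n)`
-- into `Fin n`.
injective⇒surjective : ∀ {n} {f : Fin n → Fin n} → Injective _≡_ _≡_ f →
                       ∀ y → ∃[ x ] f x ≡ y
injective⇒surjective {suc n} {f} f-inj y with any? (λ x → f x ≟ y)
... | yes found = found
... | no missed =
  ⊥-elim (<⇒notInjective {f = punchOut ∘ avoids} (ℕ.n<1+n n)
           (f-inj ∘ punchOut-injective (avoids _) (avoids _)))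
  where
  avoids : ∀ x → y ≢ f x
  avoids x y≡fx = missed (x , sym y≡fx)

sum-mono-≤ : ∀ {n} {f g : Vector ℕ n} → (∀ x → f x ≤ g x) → sum f ≤ sum g
sum-mono-≤ {zero}  f≤g = z≤n
sum-mono-≤ {suc n} f≤g = ℕ.+-mono-≤ (f≤g zero) (sum-mono-≤ (f≤g ∘ suc))

sum-mono-< : ∀ {n} {f g : Vector ℕ n} → (∀ x → f x ≤ g x) →
             ∀ u → f u < g u → sum f < sum g
sum-mono-< f≤g zero    fu<gu = ℕ.+-mono-<-≤ fu<gu (sum-mono-≤ (f≤g ∘ suc))
sum-mono-< f≤g (suc u) fu<gu = ℕ.+-mono-≤-< (f≤g zero) (sum-mono-< (f≤g ∘ suc) u fu<gu)

-- Because `u ≢ v`, the two strict inequalities sit in different summands, and each contributes a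
-- unit. The recursion strips common leading positions until one index is `zero`; the other then
-- lies in the tail and gains its unit through `sum-mono-<`.
sum-mono-<₂ : ∀ {n} {f g : Vector ℕ n} → (∀ x → f x ≤ g x) →
              ∀ {u v} → u ≢ v → f u < g u → f v < g v → sum f + 2 ≤ sum g
sum-mono-<₂ f≤g {zero} {zero} u≢v _ _ = contradiction refl u≢v
sum-mono-<₂ {f = f} {g} f≤g {zero} {suc v} _ fu<gu fv<gv = begin
  f zero + sum (f ∘ suc) + 2          ≡⟨ ℕ.+-comm _ 2 ⟩
  suc (suc (f zero + sum (f ∘ suc)))  ≡⟨ cong suc (ℕ.+-suc _ _) ⟨
  suc (f zero) + suc (sum (f ∘ suc))  ≤⟨ ℕ.+-mono-≤ fu<gu (sum-mono-< (f≤g ∘ suc) v fv<gv) ⟩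
  g zero + sum (g ∘ suc)              ∎
  where open ℕ.≤-Reasoning
sum-mono-<₂ f≤g {suc u} {zero} u≢v fu<gu fv<gv = sum-mono-<₂ f≤g (u≢v ∘ sym) fv<gv fu<gu
sum-mono-<₂ {f = f} {g} f≤g {suc u} {suc v} u≢v fu<gu fv<gv = begin
  f zero + sum (f ∘ suc) + 2    ≡⟨ ℕ.+-assoc (f zero) _ 2 ⟩
  f zero + (sum (f ∘ suc) + 2)  ≤⟨ ℕ.+-mono-≤ (f≤g zero)
                                     (sum-mono-<₂ (f≤g ∘ suc) (u≢v ∘ cong suc) fu<gu fv<gv) ⟩
  g zero + sum (g ∘ suc)        ∎
  where open ℕ.≤-Reasoning

-- The strict hypotheses compare `f` and `g` at different indices. Reindexing `f` by the
-- transposition of `u` and `v` keeps its sum and turns them into strict inequalities at a common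
-- index.
sum-exchange : ∀ {n} {f g : Vector ℕ n} → (∀ x → f x ≤ g x) →
               ∀ {u v} → u ≢ v → f v < g u → f u < g v → sum f + 2 ≤ sum g
sum-exchange {f = f} {g} f≤g {u} {v} u≢v fv<gu fu<gv =
  subst (λ s → s + 2 ≤ sum g) (sym (sum-permute f π))
        (sum-mono-<₂ f∘π≤g u≢v f∘π<g-at-u f∘π<g-at-v)
  where
  π = transpose u v

  f∘π≤g : ∀ x → f (π ⟨$⟩ʳ x) ≤ g x
  -- The tests come in the order in which `transpose` makes them, so that `π ⟨$⟩ʳ x` reduces in
  -- every branch.
  f∘π≤g x with x ≟ u
  ... | yes refl = ℕ.<⇒≤ fv<gu
  ... | no _ with x ≟ v
  ...   | yes refl = ℕ.<⇒≤ fu<gv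
  ...   | no _     = f≤g x

  f∘π<g-at-u : f (π ⟨$⟩ʳ u) < g u
  f∘π<g-at-u with u ≟ u
  ... | yes _  = fv<gu
  ... | no u≢u = contradiction refl u≢u

  f∘π<g-at-v : f (π ⟨$⟩ʳ v) < g v
  f∘π<g-at-v with v ≟ u
  ... | yes v≡u = contradiction (sym v≡u) u≢v
  ... | no _ with v ≟ v
  ...   | yes _  = fu<gv
  ...   | no v≢v = contradiction refl v≢v

module _ {n : ℕ} {G : SimpleGraph n} (w : Edge G → ℕ) where
  -- Lowered by one, the weights of the `q` edges give an injection of `Fin q` into itself, which is
  -- onto; an edge sent to `i` has weight `suc i`.
  weight-attained : ∀ {q} → Edge G ↔ Fin q → (∀ e → 1 ≤ w e × w e ≤ q) →
                    Injective _≡_ _≡_ w → ∀ {i} → i < q → ∃[ e ] w e ≡ suc i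
  weight-attained {q} E↔q w-bounds w-inj i<q =
    let j , eq = injective⇒surjective index-inj (fromℕ< i<q)
    in edgeAt j ,
       trans (sym (suc-pred-w _)) (cong suc (fromℕ<-injective _ _ (pred-w<q _) i<q eq))
    where
    edgeAt : Fin q → Edge G
    edgeAt = Inverse.from E↔q

    suc-pred-w : ∀ e → suc (pred (w e)) ≡ w e
    suc-pred-w e = ℕ.suc-pred (w e) {{>-nonZero (proj₁ (w-bounds e))}}

    pred-w<q : ∀ e → pred (w e) < q
    pred-w<q e = subst (_≤ q) (sym (suc-pred-w e)) (proj₂ (w-bounds e))

    index : Fin q → Fin q
    index j = fromℕ< (pred-w<q (edgeAt j))

    index-inj : Injective _≡_ _≡_ index
    -- Weights are positive, so `pred` merges no two of them: equal indices force equal weights,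
    -- hence equal edges, hence equal edge numbers.
    index-inj eq = Injection.injective (↔⇒↣ (↔-sym E↔q)) (w-inj
      (trans (sym (suc-pred-w _))
        (trans (cong suc (fromℕ<-injective _ _ (pred-w<q _) (pred-w<q _) eq))
          (suc-pred-w _))))

  L-mono : ∀ {i j} → i ≤ j → ∀ v → L w i v ≤ L w j v
  L-mono {i} {j} i≤j v
    with (es , (trail , dec , light) , len) , _ ← proj₂ (longest w i v)
    = subst (_≤ L w j v) len
        (proj₂ (proj₂ (longest w j v)) es
          (trail , dec , All.map (λ wf≤i → ℕ.≤-trans wf≤i i≤j) light))

  -- All edges of `es` weigh at most `i`, hence less than `e`. This one fact shows both that `e` is
  -- new to the trail and that the weights still decrease.
  admissible-∷ : ∀ {i u v e es} → w e ≡ suc i → Joins e u v →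
                 Admissible w i v es → Admissible w (suc i) u (e ∷ es)
  admissible-∷ {i} {e = e} we≡1+i joins ((unique , walk) , dec , light) =
    (All.map heavier⇒≢ lighter ∷ unique , joins ∷ walk) ,
    extend lighter dec ,
    ℕ.≤-reflexive we≡1+i ∷ All.map ℕ.m≤n⇒m≤1+n light
    where
    lighter : All (λ f → w f < w e) _
    lighter = All.map (λ wf≤i → ℕ.≤-trans (s≤s wf≤i) (ℕ.≤-reflexive (sym we≡1+i))) light

    heavier⇒≢ : ∀ {f} → w f < w e → e ≢ f
    heavier⇒≢ wf<we refl = ℕ.<-irrefl refl wf<we

    extend : ∀ {es} → All (λ f → w f < w e) es →
             StrictlyDecreasing w es → StrictlyDecreasing w (e ∷ es)
    extend []          _   = [-]
    extend (wf<we ∷ _) dec = wf<we ∷ dec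

  L-step : ∀ {i u v e} → w e ≡ suc i → Joins e u v → L w i v < L w (suc i) u
  L-step {i} {u} {v} {e} we≡1+i joins
    with (es , adm , len) , _ ← proj₂ (longest w i v)
    = subst (_< L w (suc i) u) len
        -- `length (e ∷ es)` is `suc (length es)` by definition, so the maximality bound is already
        -- the strict inequality.
        (proj₂ (proj₂ (longest w (suc i) u)) (e ∷ es) (admissible-∷ we≡1+i joins adm))

lemma1 : ∀ {n q : ℕ} (G : SimpleGraph n) → Edge G ↔ Fin q →
    (w : Edge G → ℕ) → (∀ e → 1 ≤ w e × w e ≤ q) → Injective _≡_ _≡_ w →
    ∀ i → i < q → sum (L w (suc i)) ≥ sum (L w i) + 2
lemma1 G E↔q w w-bounds w-inj i i<q =
  let e , we≡1+i = weight-attained w E↔q w-bounds w-inj i<q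
  in sum-exchange (L-mono w (ℕ.n≤1+n i)) (<⇒≢ (Edge.lo<hi e))
       -- The edge is traversed once from `lo` to `hi` and once from `hi` to `lo`, giving the two
       -- crossed inequalities.
       (L-step w we≡1+i (inj₁ (refl , refl)))
       (L-step w we≡1+i (inj₂ (refl , refl)))
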